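{- (1) The class $\mathcal{U}^1_{MM}$ consists exactly of the trees, the balanced complete bipartite graphs $K_{n,n}$ ($n\ge 1$), and the complete graphs with an even number of vertices. (2) For every $k\geq 2$ (including $k=\infty$), the class $\mathcal{U}^{k}_{MM}$ consists exactly of the cycle on four vertices and the trees.
   Context: Graphs are finite, simple, undirected and connected. A matching is a set of edges no two of which share an endpoint. A maximal matching (MM) is a matching to which no edge of the graph can be added while remaining a matching. A maximal matching $M$ of $G=(V,E)$ is $k$-robust if for every set $F\subseteq E$ of at most $k$ edges such that $G-F=(V,E\setminus F)$ is connected, the set $M\setminus F$ is a maximal matching of $G-F$. For $k=\infty$ there is no bound on $|F|$. $\mathcal{U}^k_{MM}$ is the class of graphs $G$ such that every maximal matching of $G$ is $k$-robust. -}

module Defs where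

open import Data.Empty using (⊥)
open import Data.Fin.Base using (Fin; toℕ; _<_)
open import Data.Fin.Properties using (_≟_; _<?_)
open import Data.List.Base using (List; length; filter; allFin; cartesianProduct)
open import Data.Nat.Base using (ℕ; suc; _≤_)
import Data.Nat.Properties as ℕ
open import Data.Nat.Divisibility using (_∣_)
open import Data.Product.Base using (Σ-syntax; ∃-syntax; _×_; _,_)
open import Data.Sum.Base using (_⊎_; inj₁; inj₂; swap)
open import Data.Unit.Base using (⊤; tt)
open import Function.Base using (_∘_)
open import Function.Bundles using (_⇔_; _↔_; _↣_; Inverse; Injection)
open import Level using (0ℓ)
open import Relation.Binary.Construct.Add.Supremum.NonStrict _≤_ using (_≤⁺_; [_]; _≤⊤⁺) public
open import Relation.Binary.Construct.Closure.ReflexiveTransitive using (Star)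
open import Relation.Binary.Construct.Union using (_∪_)
open import Relation.Binary.Core using (Rel; _⇒_)
open import Relation.Binary.Definitions using (Symmetric; Decidable)
open import Relation.Binary.PropositionalEquality.Core using (_≡_; _≢_; refl; ≢-sym)
open import Relation.Nullary.Construct.Add.Supremum using (_⁺; [_]; ⊤⁺) public
open import Relation.Nullary.Decidable using (yes; no; ¬?; _×-dec_; _⊎-dec_)
open import Relation.Nullary.Negation.Core using (¬_)

private
  variable
    V W : Set
    n : ℕ

-- A set of edges S on the vertex set V is identified with the graph (V , S),
-- so that matchings and sets of deleted edges are also elements of Graph V.
record Graph (V : Set) : Set₁ where
  field
    Adj    : Rel V 0ℓ
    sym    : Symmetric Adj
    irrefl : ∀ {u} → ¬ Adj u u
    adj?   : Decidable Adj

open Graph public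

infix 4 _⊆_ _≅_ _↪_
infixl 6 _∖_

_⊆_ : Graph V → Graph V → Set
F ⊆ G = Adj F ⇒ Adj G

_∖_ : Graph V → Graph V → Graph V
(G ∖ F) .Adj u v          = Adj G u v × ¬ Adj F u v
(G ∖ F) .sym (uv , uv∉F)  = sym G uv , uv∉F ∘ sym F
(G ∖ F) .irrefl (uu , _)  = irrefl G uu
(G ∖ F) .adj? u v         = adj? G u v ×-dec ¬? (adj? F u v)

-- Each edge is counted once, as the pair (u , v) with u < v.
edges : Graph (Fin n) → List (Fin n × Fin n)
edges {n} G =
  filter (λ (u , v) → (u <? v) ×-dec adj? G u v)
         (cartesianProduct (allFin n) (allFin n))

∣_∣ : Graph (Fin n) → ℕ
∣ G ∣ = length (edges G)

-- The graph on the empty vertex set is not connected.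
Connected : Graph V → Set
Connected {V} G = V × (∀ u v → Star (Adj G) u v)

_≅_ : Graph V → Graph W → Set
_≅_ {V} {W} G H =
  Σ[ f ∈ V ↔ W ] (∀ u v → Adj G u v ⇔ Adj H (Inverse.to f u) (Inverse.to f v))

-- H is isomorphic to a (not necessarily induced) subgraph of G.
_↪_ : Graph W → Graph V → Set
_↪_ {W} {V} H G =
  Σ[ f ∈ W ↣ V ] (∀ {u v} → Adj H u v → Adj G (Injection.to f u) (Injection.to f v))

K : (n : ℕ) → Graph (Fin n)
K n .Adj          = _≢_
K n .sym          = ≢-sym
K n .irrefl u≢u   = u≢u refl
K n .adj? u v     = ¬? (u ≟ v)

K[_,_] : (m n : ℕ) → Graph (Fin m ⊎ Fin n)
K[ m , n ] = record { Adj = A ; sym = λ {u} {v} → A-sym u v ; irrefl = λ {u} → A-irrefl u ; adj? = A? }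
  where
  A : Rel (Fin m ⊎ Fin n) 0ℓ
  A (inj₁ _) (inj₁ _) = ⊥
  A (inj₁ _) (inj₂ _) = ⊤
  A (inj₂ _) (inj₁ _) = ⊤
  A (inj₂ _) (inj₂ _) = ⊥

  A-sym : ∀ u v → A u v → A v u
  A-sym (inj₁ _) (inj₂ _) tt = tt
  A-sym (inj₂ _) (inj₁ _) tt = tt

  A-irrefl : ∀ u → ¬ A u u
  A-irrefl (inj₁ _) ()
  A-irrefl (inj₂ _) ()

  A? : Decidable A
  A? (inj₁ _) (inj₁ _) = no λ ()
  A? (inj₁ _) (inj₂ _) = yes tt
  A? (inj₂ _) (inj₁ _) = yes tt
  A? (inj₂ _) (inj₂ _) = no λ ()

-- v is the cyclic successor of u in 0 , 1 , … , n - 1 , 0.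
Next : Rel (Fin n) 0ℓ
Next {n} u v = toℕ v ≡ suc (toℕ u) ⊎ (suc (toℕ u) ≡ n × toℕ v ≡ 0)

-- The cycle on n vertices, meaningful for n ≥ 3.
C : (n : ℕ) → Graph (Fin n)
C n .Adj u v               = u ≢ v × (Next u v ⊎ Next v u)
C n .sym (u≢v , uv)        = ≢-sym u≢v , swap uv
C n .irrefl (u≢u , _)      = u≢u refl
C n .adj? u v              = ¬? (u ≟ v) ×-dec (next? u v ⊎-dec next? v u)
  where
  next? : Decidable (Next {n})
  next? x y = (toℕ y ℕ.≟ suc (toℕ x)) ⊎-dec ((suc (toℕ x) ℕ.≟ n) ×-dec (toℕ y ℕ.≟ 0))

Acyclic : Graph V → Set
Acyclic G = ∀ m → 3 ≤ m → ¬ (C m ↪ G)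

IsTree : Graph V → Set
IsTree G = Connected G × Acyclic G

IsBalancedCompleteBipartite : Graph V → Set
IsBalancedCompleteBipartite G = ∃[ m ] (1 ≤ m × G ≅ K[ m , m ])

IsEvenComplete : Graph V → Set
IsEvenComplete G = ∃[ m ] (2 ∣ m × G ≅ K m)

-- The relation consisting of the single undirected edge uv.
Edge : V → V → Rel V 0ℓ
Edge u v x y = (x ≡ u × y ≡ v) ⊎ (x ≡ v × y ≡ u)

-- For a symmetric relation R: edges of R sharing an endpoint x coincide.
IsMatching : Rel V 0ℓ → Set
IsMatching R = ∀ {x y z} → R x y → R x z → y ≡ z

record IsMaximalMatching (G M : Graph V) : Set where
  field
    subset   : M ⊆ G
    matching : IsMatching (Adj M)
    maximal  : ∀ {u v} → Adj G u v → ¬ Adj M u v → ¬ IsMatching (Adj M ∪ Edge u v)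

-- The bound k = ∞ is ⊤⁺.
Robust : ℕ ⁺ → (G M : Graph (Fin n)) → Set₁
Robust k G M =
  ∀ F → F ⊆ G → [ ∣ F ∣ ] ≤⁺ k → Connected (G ∖ F) → IsMaximalMatching (G ∖ F) (M ∖ F)

U-MM : ℕ ⁺ → Graph (Fin n) → Set₁
U-MM k G = ∀ M → IsMaximalMatching G M → Robust k G M

{-# OPTIONS --safe #-}

-- Deleting an edge xy of a maximal matching M keeps it maximal iff M covers all
-- neighbours of x and y, so in the 1-robust class every maximal matching through
-- a non-bridge xy covers those neighbours. Exchanging edges of such a matching
-- turns any cycle into a 4-cycle and spreads 4-cycles along edges. Hence a
-- non-tree of the class has no bridge, and all its maximal matchings are perfect.
-- Then every path a b c d closes up to a 4-cycle (exchange ab and cd for bc), so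
-- the graph is complete if it has a triangle, and otherwise it is complete
-- bipartite with parts N(a) and N(b) for any edge ab.
-- For k ≥ 2, deleting two matched opposite edges of a 4-cycle breaks maximality
-- unless it disconnects the graph, which happens only if the graph is that 4-cycle.
module Submission where

open import Defs
open import Data.Empty using (⊥; ⊥-elim)
open import Data.Fin.Base as Fin using (Fin; zero; suc; toℕ; fromℕ; inject₁)
open import Data.Fin.Properties
  using (_≟_; _<?_; any?; all?; injective⇒≤; <-cmp; <-asym; toℕ-injective;
         toℕ-inject₁; toℕ-fromℕ; +↔⊎; suc-injective)
open import Data.Fin using (#_)
open import Data.Fin.Induction using (<-weakInduction)
open import Data.Fin.Permutation using (↔⇒≡)
open import Data.List.Base using (List; []; _∷_; length; lookup; filter; allFin; cartesianProduct)
open import Data.List.Membership.Propositional using (_∈_)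
open import Data.List.Membership.Propositional.Properties
  using (∈-allFin; ∈-filter⁺; ∈-filter⁻; ∈-cartesianProduct⁺; ∈-lookup)
open import Data.List.Relation.Unary.All as All using (All; []; _∷_)
open import Data.List.Relation.Unary.AllPairs.Core using ([]; _∷_)
open import Data.List.Relation.Unary.Any using (here; there; index)
open import Data.List.Relation.Unary.Any.Properties using (lookup-index)
open import Data.List.Relation.Unary.Unique.Propositional using (Unique)
import Data.List.Relation.Unary.Unique.Propositional.Properties as Unique
open import Data.Nat.Base using (ℕ; zero; suc; _+_; _*_; _≤_; z≤n; s≤s)
import Data.Nat.Properties as ℕ
open import Data.Nat.Divisibility using (_∣_; divides; ∣m+n∣m⇒∣n; ∣1⇒≡1)
open import Data.Product.Base using (Σ-syntax; ∃-syntax; _×_; _,_; proj₁; proj₂)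
open import Data.Sum.Base as Sum using (_⊎_; inj₁; inj₂; swap; [_,_]′)
open import Data.Sum.Properties using (swap-↔; inj₂-injective)
open import Data.Unit.Base using (tt)
open import Function.Base using (_∘_; id)
open import Function.Bundles
  using (_⇔_; _↔_; mk⇔; mk↔ₛ′; mk↣; Equivalence; Inverse; Injection)
open import Function.Construct.Composition using (_↔-∘_; _⇔-∘_)
open import Function.Construct.Symmetry using (↔-sym)
open import Function.Construct.Identity using (↔-id)
open import Level using (0ℓ)
open import Relation.Binary.Construct.Add.Supremum.NonStrict _≤_ using (≤⁺-trans)
open import Relation.Binary.Construct.Closure.ReflexiveTransitive as Star using (Star; ε; _◅_; _◅◅_)
open import Relation.Binary.Construct.Union using (_∪_)
open import Relation.Binary.Core using (Rel; _⇒_)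
open import Relation.Binary.Definitions using (Decidable; tri<; tri≈; tri>)
open import Relation.Binary.PropositionalEquality.Core
  using (_≡_; _≢_; refl; trans; cong; subst; subst₂; ≢-sym)
import Relation.Binary.PropositionalEquality.Core as ≡
open import Relation.Nullary.Decidable
  using (Dec; yes; no; ¬?; _×-dec_; _⊎-dec_; _→-dec_; decidable-stable; from-yes; from-no)
open import Relation.Nullary.Negation.Core using (¬_; contradiction)
open import Relation.Unary using (Pred) renaming (Decidable to Decidable₁)

private
  variable
    V W : Set
    n : ℕ

-- Single edges and covered vertices.

edge-sym : ∀ {u v x y : V} → Edge u v x y → Edge u v y x
edge-sym (inj₁ (x≡u , y≡v)) = inj₂ (y≡v , x≡u)
edge-sym (inj₂ (x≡v , y≡u)) = inj₁ (y≡u , x≡v)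

edge? : (u v : Fin n) → Decidable (Edge u v)
edge? u v x y = ((x ≟ u) ×-dec (y ≟ v)) ⊎-dec ((x ≟ v) ×-dec (y ≟ u))

edge-matching : ∀ {u v : V} → u ≢ v → IsMatching (Edge u v)
edge-matching u≢v (inj₁ (_ , refl))    (inj₁ (_ , refl))    = refl
edge-matching u≢v (inj₁ (refl , _))    (inj₂ (refl , _))    = contradiction refl u≢v
edge-matching u≢v (inj₂ (refl , _))    (inj₁ (refl , _))    = contradiction refl u≢v
edge-matching u≢v (inj₂ (_ , refl))    (inj₂ (_ , refl))    = refl

adj⇒≢ : (G : Graph V) → ∀ {u v} → Adj G u v → u ≢ v
adj⇒≢ G uv refl = irrefl G uv

Covered : Graph V → V → Set
Covered M u = ∃[ v ] Adj M u v

covered? : (M : Graph (Fin n)) → Decidable₁ (Covered M)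
covered? M u = any? (adj? M u)

Perfect : Graph V → Set
Perfect M = ∀ u → Covered M u

partner-unique : (M : Graph V) → IsMatching (Adj M) →
                 ∀ {u v w} → Adj M u v → v ≢ w → ¬ Adj M u w
partner-unique M m uv v≢w uw = v≢w (m uv uw)

Away : V → V → V → Set
Away u v x = x ≢ u × x ≢ v

-- Exchanging an edge into a matching.

∅ : Graph V
∅ .Adj _ _    = ⊥
∅ .sym ()
∅ .irrefl ()
∅ .adj? _ _   = no λ ()

-- The edges of N that meet u or v make room for the edge uv.
switch : Graph (Fin n) → (u v : Fin n) → u ≢ v → Graph (Fin n)
switch N u v _ .Adj x y = (Adj N x y × Away u v x × Away u v y) ⊎ Edge u v x y
switch N u v _ .sym (inj₁ (xy , ax , ay)) = inj₁ (sym N xy , ay , ax)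
switch N u v _ .sym (inj₂ e)              = inj₂ (edge-sym e)
switch N u v _ .irrefl (inj₁ (xx , _))             = irrefl N xx
switch N u v u≢v .irrefl (inj₂ (inj₁ (refl , u≡v))) = u≢v u≡v
switch N u v u≢v .irrefl (inj₂ (inj₂ (refl , v≡u))) = u≢v (≡.sym v≡u)
switch N u v _ .adj? x y = (adj? N x y ×-dec away? x ×-dec away? y) ⊎-dec edge? u v x y
  where
  away? : Decidable₁ (Away u v)
  away? z = ¬? (z ≟ u) ×-dec ¬? (z ≟ v)

module _ (N : Graph (Fin n)) {u v : Fin n} (u≢v : u ≢ v) where

  switch-new : Adj (switch N u v u≢v) u v
  switch-new = inj₂ (inj₁ (refl , refl))

  switch-matching : IsMatching (Adj N) → IsMatching (Adj (switch N u v u≢v))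
  switch-matching m (inj₁ (xy , _)) (inj₁ (xz , _)) = m xy xz
  switch-matching m (inj₁ (_ , (x≢u , x≢v) , _)) (inj₂ (inj₁ (x≡u , _))) = contradiction x≡u x≢u
  switch-matching m (inj₁ (_ , (x≢u , x≢v) , _)) (inj₂ (inj₂ (x≡v , _))) = contradiction x≡v x≢v
  switch-matching m (inj₂ (inj₁ (x≡u , _))) (inj₁ (_ , (x≢u , x≢v) , _)) = contradiction x≡u x≢u
  switch-matching m (inj₂ (inj₂ (x≡v , _))) (inj₁ (_ , (x≢u , x≢v) , _)) = contradiction x≡v x≢v
  switch-matching m (inj₂ e) (inj₂ e′) = edge-matching u≢v e e′

  switch-⊆ : (G : Graph (Fin n)) → N ⊆ G → Adj G u v → switch N u v u≢v ⊆ G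
  switch-⊆ G N⊆G uv (inj₁ (xy , _))            = N⊆G xy
  switch-⊆ G N⊆G uv (inj₂ (inj₁ (refl , refl))) = uv
  switch-⊆ G N⊆G uv (inj₂ (inj₂ (refl , refl))) = sym G uv

  -- Only edges of `N` meeting `u` or `v` are dropped, so a vertex left free by the exchange can
  -- have had no other partner.
  switch-lost : ∀ {x y} → ¬ Covered (switch N u v u≢v) x → Adj N x y → y ≡ u ⊎ y ≡ v
  switch-lost {x} {y} x∉ xy with y ≟ u | y ≟ v
  ... | yes y≡u | _       = inj₁ y≡u
  ... | no  _   | yes y≡v = inj₂ y≡v
  ... | no  y≢u | no  y≢v = contradiction (y , inj₁ (xy , (x≢u , x≢v) , y≢u , y≢v)) x∉
    where
    x≢u : x ≢ u
    x≢u refl = x∉ (v , inj₂ (inj₁ (refl , refl)))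
    x≢v : x ≢ v
    x≢v refl = x∉ (u , inj₂ (inj₂ (refl , refl)))

  uncovered-away : ∀ {x} → ¬ Covered (switch N u v u≢v) x → Away u v x
  uncovered-away x∉ = (λ { refl → x∉ (v , inj₂ (inj₁ (refl , refl))) })
                    , (λ { refl → x∉ (u , inj₂ (inj₂ (refl , refl))) })

  covered-switch : ∀ {x} → Away u v x → Covered (switch N u v u≢v) x →
                   ∃[ y ] Adj N x y × Away u v y
  covered-switch _ (y , inj₁ (xy , _ , ay)) = y , xy , ay
  covered-switch (x≢u , _) (_ , inj₂ (inj₁ (x≡u , _))) = contradiction x≡u x≢u
  covered-switch (_ , x≢v) (_ , inj₂ (inj₂ (x≡v , _))) = contradiction x≡v x≢v

  -- When both `u` and `v` are free, the exchange drops nothing and merely adds `uv`. This reduces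
  -- `add-matching` to `switch-matching`.
  uncovered⇒∪⊆switch : ¬ Covered N u → ¬ Covered N v →
                       (Adj N ∪ Edge u v) ⇒ Adj (switch N u v u≢v)
  uncovered⇒∪⊆switch u∉ v∉ {x} {y} (inj₁ xy) =
    inj₁ (xy , ((λ { refl → u∉ (y , xy) }) , (λ { refl → v∉ (y , xy) }))
             , ((λ { refl → u∉ (x , sym N xy) }) , (λ { refl → v∉ (x , sym N xy) })))
  uncovered⇒∪⊆switch _ _ (inj₂ e) = inj₂ e

  add-matching : IsMatching (Adj N) → ¬ Covered N u → ¬ Covered N v →
                 IsMatching (Adj N ∪ Edge u v)
  add-matching m u∉ v∉ xy xz =
    switch-matching m (uncovered⇒∪⊆switch u∉ v∉ xy) (uncovered⇒∪⊆switch u∉ v∉ xz)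

-- Maximality as domination of edges, and greedy extension.

Dominates : Graph V → Graph V → Set
Dominates M G = ∀ {u v} → Adj G u v → Covered M u ⊎ Covered M v

open IsMaximalMatching

-- An edge with both ends free could be added to `M`, by `add-matching`.
dominating : {G M : Graph (Fin n)} → IsMaximalMatching G M → Dominates M G
dominating {G = G} {M} mm {u} {v} uv with covered? M u | covered? M v
... | yes u∈ | _      = inj₁ u∈
... | no  _  | yes v∈ = inj₂ v∈
... | no  u∉ | no  v∉ =
  ⊥-elim (maximal mm uv (λ uv∈M → u∉ (v , uv∈M)) (add-matching M (adj⇒≢ G uv) (matching mm) u∉ v∉))

-- Adding `uv` would give a covered end a second partner, unless `uv` is already in `M`.
isMaximalMatching : {G M : Graph V} → M ⊆ G → IsMatching (Adj M) → Dominates M G →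
                    IsMaximalMatching G M
isMaximalMatching M⊆G m dom .subset   = M⊆G
isMaximalMatching M⊆G m dom .matching = m
isMaximalMatching {M = M} M⊆G m dom .maximal {u} {v} uv uv∉M m′ with dom uv
... | inj₁ (w , uw) = uv∉M (subst (Adj M u) (m′ (inj₁ uw) (inj₂ (inj₁ (refl , refl)))) uw)
... | inj₂ (w , vw) = uv∉M (sym M (subst (Adj M v) (m′ (inj₁ vw) (inj₂ (inj₂ (refl , refl)))) vw))

-- Greedy extension: once the tail of `ps` is dominated, the head pair is added if it is an edge
-- with both ends free. Domination of the tail persists because the matching only grows.
extend-over : (G N : Graph (Fin n)) (ps : List (Fin n × Fin n)) → N ⊆ G → IsMatching (Adj N) →
              Σ[ M ∈ Graph (Fin n) ] N ⊆ M × M ⊆ G × IsMatching (Adj M) ×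
                All (λ (u , v) → Adj G u v → Covered M u ⊎ Covered M v) ps
extend-over G N [] N⊆G m = N , id , N⊆G , m , []
extend-over G N ((u , v) ∷ ps) N⊆G m
  with M , N⊆M , M⊆G , mM , dom ← extend-over G N ps N⊆G m
  with adj? G u v | covered? M u | covered? M v
... | no ¬uv | _      | _      = M , N⊆M , M⊆G , mM , (λ uv → contradiction uv ¬uv) ∷ dom
... | yes _  | yes u∈ | _      = M , N⊆M , M⊆G , mM , (λ _ → inj₁ u∈) ∷ dom
... | yes _  | no _   | yes v∈ = M , N⊆M , M⊆G , mM , (λ _ → inj₂ v∈) ∷ dom
... | yes uv | no u∉  | no v∉  =
  M′ , M⊆M′ ∘ N⊆M , switch-⊆ M u≢v G M⊆G uv , switch-matching M u≢v mM
     , (λ _ → inj₁ (v , switch-new M u≢v)) ∷ All.map (λ f e → grow (f e)) dom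
  where
  u≢v : u ≢ v
  u≢v = adj⇒≢ G uv
  M′ : Graph _
  M′ = switch M u v u≢v
  M⊆M′ : M ⊆ M′
  M⊆M′ e = uncovered⇒∪⊆switch M u≢v u∉ v∉ (inj₁ e)
  grow : ∀ {x y} → Covered M x ⊎ Covered M y → Covered M′ x ⊎ Covered M′ y
  grow (inj₁ (z , e)) = inj₁ (z , M⊆M′ e)
  grow (inj₂ (z , e)) = inj₂ (z , M⊆M′ e)

abstract
  extend : (G N : Graph (Fin n)) → N ⊆ G → IsMatching (Adj N) →
           Σ[ M ∈ Graph (Fin n) ] N ⊆ M × IsMaximalMatching G M
  extend {n} G N N⊆G m
    with M , N⊆M , M⊆G , mM , dom ←
      extend-over G N (cartesianProduct (allFin n) (allFin n)) N⊆G m =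
    M , N⊆M , isMaximalMatching M⊆G mM
      (λ {u} {v} → All.lookup dom (∈-cartesianProduct⁺ (∈-allFin u) (∈-allFin v)))

-- Counting edges.

lookup-injective : {A : Set} {xs : List A} → Unique xs →
                   ∀ {i j} → lookup xs i ≡ lookup xs j → i ≡ j
lookup-injective (_ ∷ _) {zero} {zero} _ = refl
lookup-injective {xs = _ ∷ xs} (x∉ ∷ _) {zero} {suc j} eq =
  contradiction eq (All.lookup x∉ (∈-lookup {xs = xs} j))
lookup-injective {xs = _ ∷ xs} (x∉ ∷ _) {suc i} {zero} eq =
  contradiction (≡.sym eq) (All.lookup x∉ (∈-lookup {xs = xs} i))
lookup-injective (_ ∷ u) {suc i} {suc j} eq = cong suc (lookup-injective u eq)

∈-index-injective : {A : Set} {xs : List A} {x y : A} (p : x ∈ xs) (q : y ∈ xs) →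
                    index p ≡ index q → x ≡ y
∈-index-injective {xs = xs} p q eq =
  trans (lookup-index p) (trans (cong (lookup xs) eq) (≡.sym (lookup-index q)))

-- Sending each position of `xs` to a position of the same entry in `ys` is injective, since `xs`
-- has no repetitions.
length-mono : {A : Set} {xs ys : List A} → Unique xs → (∀ {x} → x ∈ xs → x ∈ ys) →
              length xs ≤ length ys
length-mono {xs = xs} {ys} u sub = injective⇒≤ {f = λ i → index (sub (∈-lookup {xs = xs} i))} inj
  where
  inj : ∀ {i j} → index (sub (∈-lookup {xs = xs} i)) ≡ index (sub (∈-lookup {xs = xs} j)) → i ≡ j
  inj {i} {j} eq = lookup-injective u (∈-index-injective (sub (∈-lookup i)) (sub (∈-lookup j)) eq)

edges-unique : (F : Graph (Fin n)) → Unique (edges F)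
edges-unique {n} F = Unique.filter⁺ (λ (u , v) → (u <? v) ×-dec adj? F u v)
  (Unique.cartesianProduct⁺ (Unique.allFin⁺ n) (Unique.allFin⁺ n))

∈-edges⁺ : (F : Graph (Fin n)) {u v : Fin n} → u Fin.< v → Adj F u v → (u , v) ∈ edges F
∈-edges⁺ F {u} {v} u<v uv = ∈-filter⁺ (λ (u , v) → (u <? v) ×-dec adj? F u v)
  (∈-cartesianProduct⁺ (∈-allFin u) (∈-allFin v)) (u<v , uv)

∈-edges⁻ : (F : Graph (Fin n)) {u v : Fin n} → (u , v) ∈ edges F → u Fin.< v × Adj F u v
∈-edges⁻ {n} F p = proj₂ (∈-filter⁻ (λ (u , v) → (u <? v) ×-dec adj? F u v)
  {xs = cartesianProduct (allFin n) (allFin n)} p)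

-- The representative under which `edges` lists an undirected edge. The equal case is a default
-- value, since the ends of an edge differ.
ordered : Fin n → Fin n → Fin n × Fin n
ordered u v with <-cmp u v
... | tri< _ _ _ = u , v
... | tri≈ _ _ _ = u , v
... | tri> _ _ _ = v , u

ordered-∈-edges : (F : Graph (Fin n)) {u v : Fin n} → Adj F u v → ordered u v ∈ edges F
ordered-∈-edges F {u} {v} uv with <-cmp u v
... | tri< u<v _ _  = ∈-edges⁺ F u<v uv
... | tri≈ _ refl _ = contradiction uv (irrefl F)
... | tri> _ _ v<u  = ∈-edges⁺ F v<u (sym F uv)

ordered-≡ : (u v x y : Fin n) → ordered u v ≡ ordered x y → x ≡ u ⊎ x ≡ v
ordered-≡ u v x y eq with <-cmp u v | <-cmp x y
ordered-≡ u v x y refl | tri< _ _ _ | tri< _ _ _ = inj₁ refl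
ordered-≡ u v x y refl | tri< _ _ _ | tri≈ _ _ _ = inj₁ refl
ordered-≡ u v x y refl | tri< _ _ _ | tri> _ _ _ = inj₂ refl
ordered-≡ u v x y refl | tri≈ _ _ _ | tri< _ _ _ = inj₁ refl
ordered-≡ u v x y refl | tri≈ _ _ _ | tri≈ _ _ _ = inj₁ refl
ordered-≡ u v x y refl | tri≈ _ _ _ | tri> _ _ _ = inj₂ refl
ordered-≡ u v x y refl | tri> _ _ _ | tri< _ _ _ = inj₂ refl
ordered-≡ u v x y refl | tri> _ _ _ | tri≈ _ _ _ = inj₂ refl
ordered-≡ u v x y refl | tri> _ _ _ | tri> _ _ _ = inj₁ refl

edge-ordered : {u v x y : Fin n} → x Fin.< y → Edge u v x y → (x , y) ≡ ordered u v
edge-ordered {x = x} {y} x<y (inj₁ (refl , refl)) with <-cmp x y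
... | tri< _ _ _ = refl
... | tri≈ _ _ _ = refl
... | tri> ¬x<y _ _ = contradiction x<y ¬x<y
edge-ordered {x = x} {y} x<y (inj₂ (refl , refl)) with <-cmp y x
... | tri< _ _ ¬x<y = contradiction x<y ¬x<y
... | tri≈ _ _ ¬x<y = contradiction x<y ¬x<y
... | tri> _ _ _ = refl

∣∅∣≤0 : ∀ n → ∣ ∅ {Fin n} ∣ ≤ 0
∣∅∣≤0 n = length-mono {ys = []} (edges-unique (∅ {Fin n})) none
  where
  none : ∀ {p} → p ∈ edges (∅ {Fin n}) → p ∈ []
  none p = ⊥-elim (proj₂ (∈-edges⁻ ∅ p))

-- Deletion sets are built from `∅` by one or two exchanges, so this bounds their sizes by 1 and 2.
∣switch∣≤ : (N : Graph (Fin n)) {u v : Fin n} (u≢v : u ≢ v) → ∣ switch N u v u≢v ∣ ≤ suc ∣ N ∣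
∣switch∣≤ N {u} {v} u≢v = length-mono {ys = ordered u v ∷ edges N} (edges-unique (switch N u v u≢v)) sub
  where
  sub : ∀ {p} → p ∈ edges (switch N u v u≢v) → p ∈ ordered u v ∷ edges N
  sub p with ∈-edges⁻ (switch N u v u≢v) p
  ... | x<y , inj₁ (xy , _) = there (∈-edges⁺ N x<y xy)
  ... | x<y , inj₂ e        = here (edge-ordered x<y e)

∣∣≤1⇒same : (F : Graph (Fin n)) → ∣ F ∣ ≤ 1 → ∀ {u v x y} → Adj F u v → Adj F x y → x ≡ u ⊎ x ≡ v
∣∣≤1⇒same F ∣F∣≤1 {u} {v} {x} {y} uv xy =
  ordered-≡ u v x y (all-equal (edges F) ∣F∣≤1 (ordered-∈-edges F uv) (ordered-∈-edges F xy))
  where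
  all-equal : {A : Set} (xs : List A) → length xs ≤ 1 → ∀ {p q} → p ∈ xs → q ∈ xs → p ≡ q
  all-equal (_ ∷ []) _ (here refl) (here refl) = refl
  all-equal (_ ∷ _ ∷ _) (s≤s ())

-- Connectivity after deletion, detours and 4-cycles.

reconnect : {G F : Graph V} → Connected G → (∀ {u v} → Adj F u v → Star (Adj (G ∖ F)) u v) →
            Connected (G ∖ F)
-- A walk of `G` is rerouted edge by edge, each deleted edge being replaced by its bypass.
reconnect {G = G} {F} (v₀ , conn) bypass = v₀ , λ u v → (step Star.⋆) (conn u v)
  where
  step : Adj G ⇒ Star (Adj (G ∖ F))
  step {x} {y} xy with adj? F x y
  ... | yes xy∈F = bypass xy∈F
  ... | no  xy∉F = Star.return (xy , xy∉F)

U-anti : {G : Graph (Fin n)} {k l : ℕ ⁺} → k ≤⁺ l → U-MM l G → U-MM k G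
U-anti k≤l U M mm F F⊆G F≤k = U M mm F F⊆G (≤⁺-trans ℕ.≤-trans F≤k k≤l)

-- For an edge xy, a detour witnesses that xy is not a bridge.
Detour : Graph V → V → V → Set
Detour G x y = Star (λ u v → Adj G u v × ¬ Edge x y u v) x y

detour-sym : (G : Graph V) → ∀ {x y} → Detour G x y → Detour G y x
detour-sym G {x} {y} =
  Star.map (λ (uv , ¬e) → uv , ¬e ∘ λ { (inj₁ e) → inj₂ e ; (inj₂ e) → inj₁ e })
  ∘ Star.reverse (λ (uv , ¬e) → sym G uv , ¬e ∘ edge-sym)

-- Deletion of the vertex `x`, encoded by isolating it so that the vertex type stays `Fin n`.
avoid : Graph (Fin n) → Fin n → Graph (Fin n)
avoid G x .Adj u v                = Adj G u v × u ≢ x × v ≢ x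
avoid G x .sym (uv , u≢x , v≢x)   = sym G uv , v≢x , u≢x
avoid G x .irrefl (uu , _)        = irrefl G uu
avoid G x .adj? u v               = adj? G u v ×-dec ¬? (u ≟ x) ×-dec ¬? (v ≟ x)

-- After the first edge `xy` the walk never meets `x` again, so it cannot use `xz`.
corner-detour : (G : Graph (Fin n)) → ∀ {x y z} → Adj G x y → y ≢ z →
                Star (Adj (avoid G x)) y z → Detour G x z
corner-detour G {x} {y} {z} xy y≢z path =
  (xy , λ { (inj₁ (_ , y≡z)) → y≢z y≡z ; (inj₂ (_ , y≡x)) → adj⇒≢ G xy (≡.sym y≡x) })
  ◅ Star.map (λ (uv , u≢x , v≢x) → uv , λ { (inj₁ (u≡x , _)) → u≢x u≡x
                                          ; (inj₂ (_ , v≡x)) → v≢x v≡x }) path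

Square : Graph V → V → V → V → V → Set
Square G a b c d = Adj G a b × Adj G b c × Adj G c d × Adj G d a × a ≢ c × b ≢ d

square? : (G : Graph (Fin n)) → ∀ a b c d → Dec (Square G a b c d)
square? G a b c d = adj? G a b ×-dec adj? G b c ×-dec adj? G c d ×-dec adj? G d a
                    ×-dec ¬? (a ≟ c) ×-dec ¬? (b ≟ d)

OnSquare : Graph V → V → Set
OnSquare G a = ∃[ b ] ∃[ c ] ∃[ d ] Square G a b c d

onSquare? : (G : Graph (Fin n)) → Decidable₁ (OnSquare G)
onSquare? G a = any? λ b → any? λ c → any? λ d → square? G a b c d

square-rotate : (G : Graph V) → ∀ {a b c d} → Square G a b c d → Square G b c d a
square-rotate G (ab , bc , cd , da , a≢c , b≢d) = bc , cd , da , ab , b≢d , ≢-sym a≢c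

square-reflect : (G : Graph V) → ∀ {a b c d} → Square G a b c d → Square G a d c b
square-reflect G (ab , bc , cd , da , a≢c , b≢d) =
  sym G da , sym G cd , sym G bc , sym G ab , a≢c , ≢-sym b≢d

square-detour : (G : Graph (Fin n)) → ∀ {a b c d} → Square G a b c d → Detour G a b
square-detour G (ab , bc , cd , da , a≢c , b≢d) =
  corner-detour G (sym G da) (≢-sym b≢d)
    ( (sym G cd , adj⇒≢ G da , ≢-sym a≢c)
    ◅ (sym G bc , ≢-sym a≢c , ≢-sym (adj⇒≢ G ab)) ◅ ε)

module Pair {n} (a b c d : Fin n) (a≢b : a ≢ b) (c≢d : c ≢ d)
            (a-away : Away c d a) (b-away : Away c d b) where

  -- Built by exchanges so that the matching property and the size bound come from `switch`. The
  -- disjointness hypotheses ensure that the second exchange keeps `ab`.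
  pair : Graph (Fin n)
  pair = switch (switch ∅ a b a≢b) c d c≢d

  ab∈pair : Adj pair a b
  ab∈pair = inj₁ (switch-new ∅ a≢b , a-away , b-away)

  cd∈pair : Adj pair c d
  cd∈pair = switch-new (switch ∅ a b a≢b) c≢d

  pair-matching : IsMatching (Adj pair)
  pair-matching = switch-matching (switch ∅ a b a≢b) c≢d (switch-matching ∅ a≢b (λ ()))

  pair-⊆ : (G : Graph (Fin n)) → Adj G a b → Adj G c d → pair ⊆ G
  pair-⊆ G ab cd =
    switch-⊆ (switch ∅ a b a≢b) c≢d G (switch-⊆ ∅ a≢b G (λ ()) ab) cd

  pair-edge : ∀ {u v} → Adj pair u v → Edge a b u v ⊎ Edge c d u v
  pair-edge (inj₁ (inj₂ e , _)) = inj₁ e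
  pair-edge (inj₂ e)            = inj₂ e

  ∣pair∣≤2 : ∣ pair ∣ ≤ 2
  ∣pair∣≤2 = ℕ.≤-trans (∣switch∣≤ (switch ∅ a b a≢b) c≢d)
    (s≤s (ℕ.≤-trans (∣switch∣≤ ∅ a≢b) (s≤s (∣∅∣≤0 n))))

-- Consequences of 1-robustness.

module OneRobust {n} (G : Graph (Fin n)) (conn : Connected G) (U : U-MM [ 1 ] G) where

  -- If `z` were free, deleting `xy` would free `x` as well and make `xz` addable, while the detour
  -- keeps the graph connected.
  neighbour-covered : ∀ {M x y z} → IsMaximalMatching G M → Adj M x y → Detour G x y →
                      Adj G x z → Covered M z
  neighbour-covered {M} {x} {y} {z} mm xy detour xz = decidable-stable (covered? M z) λ z∉ →
    maximal (U M mm F F⊆G [ ∣F∣≤1 ] connected)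
      (xz , λ { (inj₂ (inj₁ (_ , refl))) → z∉ (x , sym M xy)
              ; (inj₂ (inj₂ (x≡y , _))) → x≢y x≡y })
      (λ (xz∈M , _) → z∉ (x , sym M xz∈M))
      (add-matching (M ∖ F) (adj⇒≢ G xz) (λ p q → matching mm (proj₁ p) (proj₁ q))
        (λ (w , xw , xw∉F) →
          xw∉F (subst (Adj F x) (matching mm xy xw) (switch-new ∅ x≢y)))
        (λ (w , zw , _) → z∉ (w , zw)))
    where
    x≢y : x ≢ y
    x≢y = adj⇒≢ M xy
    F : Graph (Fin n)
    F = switch ∅ x y x≢y
    F⊆G : F ⊆ G
    F⊆G = switch-⊆ ∅ x≢y G (λ ()) (subset mm xy)
    ∣F∣≤1 : ∣ F ∣ ≤ 1
    ∣F∣≤1 = ℕ.≤-trans (∣switch∣≤ ∅ x≢y) (s≤s (∣∅∣≤0 n))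
    path : Star (Adj (G ∖ F)) x y
    path = Star.map (λ (uv , ¬e) → uv , λ { (inj₂ e) → ¬e e }) detour
    connected : Connected (G ∖ F)
    connected = reconnect {G = G} {F = F} conn λ
      { (inj₂ (inj₁ (refl , refl))) → path
      ; (inj₂ (inj₂ (refl , refl))) → Star.reverse (sym (G ∖ F)) path }

  abstract
    -- A maximal extension of `N` covers `z`, by `w` say. Either `w` is free in `N`, or its partner
    -- in `N` persists in the extension and hence is `z`.
    neighbour-coverable : ∀ {N x y z} → N ⊆ G → IsMatching (Adj N) → Adj N x y → Detour G x y →
                          Adj G x z → Covered N z ⊎ ∃[ w ] Adj G z w × ¬ Covered N w
    neighbour-coverable {N} {x} {y} {z} N⊆G m xy detour xz
      with M , N⊆M , mm ← extend G N N⊆G m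
      with w , zw ← neighbour-covered mm (N⊆M xy) detour xz
      with covered? N w
    ... | no w∉ = inj₂ (w , subset mm zw , w∉)
    ... | yes (w′ , ww′) = inj₁ (w , sym N (subst (Adj N w) (matching mm (N⊆M ww′) (sym M zw)) ww′))

  -- A maximal matching M of G - z that contains xy must leave a neighbour q of z
  -- free. After exchanging xy for yz, q still has to be coverable, and x is the
  -- only vertex that became free.
  square-from-detours : ∀ {x y z} → Adj G x y → Adj G y z → x ≢ z →
                        Detour G x y → Detour G y z → ∃[ q ] Square G x y z q
  square-from-detours {x} {y} {z} xy yz x≢z dxy dyz
    with M , N⊆M , mm ← extend (avoid G z) (switch ∅ x y (adj⇒≢ G xy))
           (switch-⊆ ∅ (adj⇒≢ G xy) (avoid G z) (λ ()) (xy , x≢z , adj⇒≢ G yz))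
           (switch-matching ∅ (adj⇒≢ G xy) (λ ()))
    with xy∈M ← N⊆M (switch-new ∅ (adj⇒≢ G xy))
    with neighbour-coverable {M} (proj₁ ∘ subset mm) (matching mm)
           (sym M xy∈M) (detour-sym G dxy) yz
  ... | inj₁ (_ , zw) = contradiction refl (proj₁ (proj₂ (subset mm zw)))
  ... | inj₂ (q , zq , q∉)
    with neighbour-coverable {switch M y z (adj⇒≢ G yz)} (switch-⊆ M (adj⇒≢ G yz) G (proj₁ ∘ subset mm) yz)
           (switch-matching M (adj⇒≢ G yz) (matching mm))
           (sym (switch M y z (adj⇒≢ G yz)) (switch-new M (adj⇒≢ G yz))) (detour-sym G dyz) zq
  ... | inj₁ q∈ = contradiction
    (let w , qw , _ = covered-switch M (adj⇒≢ G yz)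
                        ((λ { refl → q∉ (x , sym M xy∈M) }) , ≢-sym (adj⇒≢ G zq)) q∈
     in w , qw) q∉
  ... | inj₂ (r , qr , r∉) with r ≟ x
  ... | yes refl = q , xy , yz , zq , qr , x≢z , λ { refl → q∉ (x , sym M xy∈M) }
  -- The edge `qr` avoids `z`, so maximality in `avoid G z` gives `r` a partner in `M`. Losing it in
  -- the exchange forces that partner to be `y`, as `z` is isolated, and then `r` would be `x`.
  ... | no r≢x
    with dominating mm (qr , ≢-sym (adj⇒≢ G zq) , proj₂ (uncovered-away M (adj⇒≢ G yz) r∉))
  ... | inj₁ q∈ = contradiction q∈ q∉
  ... | inj₂ (s , rs) with switch-lost M (adj⇒≢ G yz) r∉ rs
  ... | inj₁ refl = contradiction (matching mm (sym M rs) (sym M xy∈M)) r≢x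
  ... | inj₂ refl = contradiction refl (proj₂ (proj₂ (subset mm rs)))

  -- For a neighbour `z` off the 4-cycle, extend `xy` and `cq` to a maximal matching and exchange
  -- `xz` into it. Since `cq` survives, the vertex `y`, now free, must have a free neighbour `w`.
  -- Before the exchange `w` was covered, necessarily by `z`, which closes the 4-cycle `z w y x`.
  square-step : ∀ {x z} → OnSquare G x → Adj G x z → OnSquare G z × Detour G x z
  square-step {x} {z} (y , c , q , sq@(xy , yc , cq , qx , x≢c , y≢q)) xz
    with z ≟ y | z ≟ q | z ≟ c
  ... | yes refl | _ | _ = (_ , _ , _ , square-rotate G sq) , square-detour G sq
  ... | no _ | yes refl | _ =
    let sq′ = square-reflect G sq in (_ , _ , _ , square-rotate G sq′) , square-detour G sq′
  -- Here `xz` is a chord of the 4-cycle and is bypassed through `y`.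
  ... | no _ | no _ | yes refl =
      (_ , _ , _ , square-rotate G (square-rotate G sq))
    , corner-detour G xy (adj⇒≢ G yc) ((yc , ≢-sym (adj⇒≢ G xy) , ≢-sym x≢c) ◅ ε)
  ... | no z≢y | no z≢q | no z≢c = exchange
    where
    open Pair x y c q (adj⇒≢ G xy) (adj⇒≢ G cq)
              (x≢c , ≢-sym (adj⇒≢ G qx)) (adj⇒≢ G yc , y≢q)
    x≢z : x ≢ z
    x≢z = adj⇒≢ G xz
    exchange : OnSquare G z × Detour G x z
    exchange
      with M , N⊆M , mm ← extend G pair (pair-⊆ G xy cq) pair-matching
      with neighbour-coverable {switch M x z x≢z} {c} {q} {y}
             (switch-⊆ M x≢z G (subset mm) xz)
             (switch-matching M x≢z (matching mm))
             (inj₁ (N⊆M cd∈pair , (≢-sym x≢c , ≢-sym z≢c) , (adj⇒≢ G qx , ≢-sym z≢q)))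
             (square-detour G (square-rotate G (square-rotate G sq)))
             (sym G yc)
    ... | inj₁ y∈
      with s , ys , s≢x , _ ← covered-switch M x≢z (≢-sym (adj⇒≢ G xy) , ≢-sym z≢y) y∈ =
      contradiction (matching mm ys (sym M (N⊆M ab∈pair))) s≢x
    ... | inj₂ (w , yw , w∉)
      with s , ws ← neighbour-covered mm (sym M (N⊆M ab∈pair)) (detour-sym G (square-detour G sq)) yw
      with switch-lost M x≢z w∉ ws
    ... | inj₁ refl = contradiction (matching mm (N⊆M ab∈pair) (sym M ws)) (adj⇒≢ G yw)
    ... | inj₂ refl = (_ , _ , _ , sq′)
        , square-detour G (square-rotate G (square-rotate G (square-rotate G sq′)))
      where
      sq′ : Square G z w y x
      sq′ = sym G (subset mm ws) , sym G yw , sym G xy , xz , z≢y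
          , proj₁ (uncovered-away M x≢z w∉)

  all-on-square : ∀ {x} → OnSquare G x → ∀ v → OnSquare G v
  all-on-square {x} on v = go on (proj₂ conn x v)
    where
    go : ∀ {u} → OnSquare G u → Star (Adj G) u v → OnSquare G v
    go on ε         = on
    go on (uw ◅ ws) = go (proj₁ (square-step on uw)) ws

  -- Every vertex lies on a 4-cycle, so every edge has a detour, and `neighbour-covered` spreads
  -- coverage along walks from a covered end of `xy`.
  square⇒perfect : ∀ {x} → OnSquare G x → ∀ M → IsMaximalMatching G M → Perfect M
  square⇒perfect {x} on@(_ , _ , _ , xy , _) M mm v = go′ (dominating mm xy)
    where
    go : ∀ {u} → Covered M u → Star (Adj G) u v → Covered M v
    go u∈ ε = u∈
    go (w , uw) (uz ◅ zs) = go (neighbour-covered mm uw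
      (proj₂ (square-step (all-on-square on _) (subset mm uw))) uz) zs
    go′ : ∀ {u w} → Covered M u ⊎ Covered M w → Covered M v
    go′ {u} (inj₁ u∈) = go u∈ (proj₂ conn u v)
    go′ {_} {w} (inj₂ w∈) = go w∈ (proj₂ conn w v)

-- Isomorphisms, and involutions without fixed points.

both : {A B : Set} → A → B → A ⇔ B
both a b = mk⇔ (λ _ → b) (λ _ → a)

neither : {A B : Set} → ¬ A → ¬ B → A ⇔ B
neither ¬a ¬b = mk⇔ (⊥-elim ∘ ¬a) (⊥-elim ∘ ¬b)

≅-inverse : {G : Graph V} {H : Graph W} (e : W ↔ V) →
            (∀ s t → Adj G (Inverse.to e s) (Inverse.to e t) ⇔ Adj H s t) → G ≅ H
≅-inverse {G = G} {H} e adjacent = ↔-sym e , λ u v → mk⇔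
  (λ uv → Equivalence.to (adjacent _ _)
    (subst₂ (Adj G) (≡.sym (to∘from u)) (≡.sym (to∘from v)) uv))
  (λ st → subst₂ (Adj G) (to∘from u) (to∘from v) (Equivalence.from (adjacent _ _) st))
  where
  to∘from : ∀ x → Inverse.to e (Inverse.from e x) ≡ x
  to∘from x = Inverse.strictlyInverseˡ e x

-- `P` selects exactly one element of each orbit of `f`. Listing the selected elements enumerates
-- one half, and `f` carries it onto the other.
involution⇒halves : (f : Fin n → Fin n) → (∀ x → f (f x) ≡ x) →
                    {P : Pred (Fin n) 0ℓ} → Decidable₁ P →
                    (∀ {x} → P x → ¬ P (f x)) → (∀ {x} → ¬ P x → P (f x)) →
                    ∃[ m ] Σ[ e ∈ (Fin m ⊎ Fin m) ↔ Fin n ]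
                      (∀ i → P (Inverse.to e (inj₁ i))) × (∀ i → ¬ P (Inverse.to e (inj₂ i)))
involution⇒halves {n} f f-inv {P} P? P⇒¬P ¬P⇒P =
  m , mk↔ₛ′ to from to∘from (λ s → to-injective (from (to s)) s (to∘from (to s)))
    , P-lookup , λ i → P⇒¬P (P-lookup i)
  where
  xs : List (Fin n)
  xs = filter P? (allFin n)
  m : ℕ
  m = length xs
  unique : Unique xs
  unique = Unique.filter⁺ P? (Unique.allFin⁺ n)
  P-lookup : ∀ i → P (lookup xs i)
  P-lookup i = proj₂ (∈-filter⁻ P? {xs = allFin n} (∈-lookup {xs = xs} i))
  to : Fin m ⊎ Fin m → Fin n
  to (inj₁ i) = lookup xs i
  to (inj₂ i) = f (lookup xs i)
  ∈xs : ∀ {x} → P x → x ∈ xs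
  ∈xs {x} Px = ∈-filter⁺ P? (∈-allFin x) Px
  from : Fin n → Fin m ⊎ Fin m
  from x with P? x
  ... | yes Px = inj₁ (index (∈xs Px))
  ... | no ¬Px = inj₂ (index (∈xs (¬P⇒P ¬Px)))
  to∘from : ∀ x → to (from x) ≡ x
  to∘from x with P? x
  ... | yes Px = ≡.sym (lookup-index (∈xs Px))
  ... | no ¬Px = trans (cong f (≡.sym (lookup-index (∈xs (¬P⇒P ¬Px))))) (f-inv x)
  to-injective : ∀ s t → to s ≡ to t → s ≡ t
  to-injective (inj₁ i) (inj₁ j) eq = cong inj₁ (lookup-injective unique eq)
  to-injective (inj₁ i) (inj₂ j) eq =
    contradiction (subst P eq (P-lookup i)) (P⇒¬P (P-lookup j))
  to-injective (inj₂ i) (inj₁ j) eq =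
    contradiction (subst P (≡.sym eq) (P-lookup j)) (P⇒¬P (P-lookup i))
  to-injective (inj₂ i) (inj₂ j) eq = cong inj₂ (lookup-injective unique
    (trans (≡.sym (f-inv _)) (trans (cong f eq) (f-inv _))))

involution⇒even : (f : Fin n → Fin n) → (∀ x → f (f x) ≡ x) → (∀ x → f x ≢ x) → 2 ∣ n
involution⇒even {n} f f-inv f-≢ =
  divides (proj₁ halves) (trans (≡.sym (↔⇒≡ (proj₁ (proj₂ halves) ↔-∘ +↔⊎))) (double (proj₁ halves)))
  where
  descends : ∀ {x} → ¬ x Fin.< f x → f x Fin.< x
  descends {x} x≮fx with <-cmp x (f x)
  ... | tri< x<fx _ _ = contradiction x<fx x≮fx
  ... | tri≈ _ x≡fx _ = contradiction (≡.sym x≡fx) (f-≢ x)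
  ... | tri> _ _ fx<x = fx<x
  -- Each orbit is represented by its smaller element.
  halves = involution⇒halves f f-inv {λ x → x Fin.< f x} (λ x → x <? f x)
    (λ {x} x<fx fx<ffx → <-asym x<fx (subst (f x Fin.<_) (f-inv x) fx<ffx))
    (λ {x} x≮fx → subst (f x Fin.<_) (≡.sym (f-inv x)) (descends x≮fx))
  double : ∀ k → k + k ≡ k * 2
  double k = trans (cong (k +_) (≡.sym (ℕ.+-identityʳ k))) (ℕ.*-comm 2 k)

-- Graphs all of whose maximal matchings are perfect.

module RandomlyMatchable {n} (G : Graph (Fin n)) (perfect : ∀ M → IsMaximalMatching G M → Perfect M) where

  -- Exchange ab and cd for bc: only a and d are free, so they must be adjacent.
  path-closed : ∀ {a b c d} → Adj G a b → Adj G b c → Adj G c d →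
                a ≢ c → b ≢ d → a ≢ d → Adj G a d
  path-closed {a} {b} {c} {d} ab bc cd a≢c b≢d a≢d = exchange
    where
    open Pair a b c d (adj⇒≢ G ab) (adj⇒≢ G cd) (a≢c , a≢d) (adj⇒≢ G bc , b≢d)
    b≢c : b ≢ c
    b≢c = adj⇒≢ G bc
    exchange : Adj G a d
    exchange
      with M , N⊆M , mm ← extend G pair (pair-⊆ G ab cd) pair-matching
      with M′ , S⊆M′ , mm′ ← extend G (switch M b c b≢c)
             (switch-⊆ M b≢c G (subset mm) bc) (switch-matching M b≢c (matching mm))
      with r , ar ← perfect M′ mm′ a
      with s , rs ← perfect M mm r
      with covered? (switch M b c b≢c) r
    ... | yes (t , rt)
      with refl ← matching mm′ (S⊆M′ rt) (sym M′ ar)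
      with w , aw , w≢b , _ ← covered-switch M b≢c (adj⇒≢ G ab , a≢c)
                                (r , sym (switch M b c b≢c) rt) =
      contradiction (matching mm aw (N⊆M ab∈pair)) w≢b
    ... | no r∉ with switch-lost M b≢c r∉ rs
    ... | inj₁ refl = contradiction (matching mm (N⊆M (sym pair ab∈pair)) (sym M rs))
                                    (adj⇒≢ M′ ar)
    ... | inj₂ refl = subst (Adj G a) (matching mm (sym M rs) (N⊆M cd∈pair)) (subset mm′ ar)

  private
    someMatching : Σ[ M ∈ Graph (Fin n) ] ∅ ⊆ M × IsMaximalMatching G M
    someMatching = extend G ∅ (λ ()) (λ ())
    M₀ : Graph (Fin n)
    M₀ = proj₁ someMatching
    mm₀ : IsMaximalMatching G M₀
    mm₀ = proj₂ (proj₂ someMatching)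

  partner : Fin n → Fin n
  partner v = proj₁ (perfect M₀ mm₀ v)

  partner-adj : ∀ v → Adj G v (partner v)
  partner-adj v = subset mm₀ (proj₂ (perfect M₀ mm₀ v))

  partner-involutive : ∀ v → partner (partner v) ≡ v
  partner-involutive v = matching mm₀ (proj₂ (perfect M₀ mm₀ (partner v)))
                                      (sym M₀ (proj₂ (perfect M₀ mm₀ v)))

  partner-≢ : ∀ v → partner v ≢ v
  partner-≢ v = ≢-sym (adj⇒≢ G (partner-adj v))

  -- The involution `partner` of one fixed perfect matching yields evenness in the complete case. In
  -- the bipartite case it swaps the two sides and so yields balance.
  complete-or-bipartite : Connected G → ∀ {a b} → Adj G a b →
                          IsBalancedCompleteBipartite G ⊎ IsEvenComplete G
  complete-or-bipartite conn {a} {b} ab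
    with any? (λ u → any? λ v → any? λ w → adj? G u v ×-dec adj? G v w ×-dec adj? G w u)
  ... | yes (u , v , w , uv , vw , wu) =
    inj₂ (_ , involution⇒even partner partner-involutive partner-≢ , ↔-id _
            , λ x y → mk⇔ (adj⇒≢ G) (λ x≢y → complete x≢y))
    where
    OnTriangle : Fin n → Set
    OnTriangle x = ∃[ y ] ∃[ z ] Adj G x y × Adj G y z × Adj G z x

    -- If `y` is off the triangle `x p q`, the path `y x p q` closes up with `yq`, so `q` serves as
    -- the third vertex.
    third : ∀ {x y} → OnTriangle x → Adj G x y → ∃[ t ] Adj G x t × Adj G t y
    third {x} {y} (p , q , xp , pq , qx) xy with y ≟ p | y ≟ q
    ... | yes refl | _        = q , sym G qx , sym G pq
    ... | no _     | yes refl = p , xp , pq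
    ... | no y≢p   | no y≢q   = q , sym G qx
      , sym G (path-closed (sym G xy) xp pq y≢p (≢-sym (adj⇒≢ G qx)) y≢q)

    all-on-triangle : ∀ x → OnTriangle x
    all-on-triangle x = go (v , w , uv , vw , wu) (proj₂ conn u x)
      where
      go : ∀ {y} → OnTriangle y → Star (Adj G) y x → OnTriangle x
      go on ε = on
      go on (yz ◅ zs) with t , yt , tz ← third on yz = go (t , _ , sym G tz , sym G yt , yz) zs

    -- Adjacency to `x` is carried along a walk: given `xz` and `zw`, a common neighbour `t` of `x`
    -- and `z` produces the path `x t z w`, which closes up with `xw`.
    complete : ∀ {x y} → x ≢ y → Adj G x y
    complete {x} {y} x≢y = go (inj₁ refl) (proj₂ conn x y)
      where
      go : ∀ {z} → x ≡ z ⊎ Adj G x z → Star (Adj G) z y → Adj G x y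
      go (inj₁ x≡y) ε = contradiction x≡y x≢y
      go (inj₂ xy)  ε = xy
      go (inj₁ refl) (zw ◅ ws) = go (inj₂ zw) ws
      go (inj₂ xz) (_◅_ {j = w} zw ws) with x ≟ w
      ... | yes x≡w = go (inj₁ x≡w) ws
      ... | no x≢w with t , xt , tz ← third (all-on-triangle x) xz with t ≟ w
      ... | yes refl = go (inj₂ xt) ws
      ... | no t≢w = go (inj₂ (path-closed xt tz zw (adj⇒≢ G xz) t≢w x≢w)) ws
  ... | no no-triangle =
    inj₁ (proj₁ split , side-nonempty (Inverse.from (proj₁ (proj₂ split)) a)
         , ≅-inverse {G = G} {K[ m , m ]} (proj₁ (proj₂ split)) adjacent)
    where
    ¬triangle : ∀ {u v w} → Adj G u v → Adj G v w → ¬ Adj G w u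
    ¬triangle uv vw wu = no-triangle (_ , _ , _ , uv , vw , wu)

    near : ∀ x → Adj G a x ⊎ Adj G b x
    near x = go (inj₁ ab) (proj₂ conn b x)
      where
      -- When its four vertices are distinct, the path `d c y z` closes up with `dz`.
      advance : ∀ {c d y z} → Adj G c d → Adj G c y → Adj G y z → Adj G c z ⊎ Adj G d z
      advance {c} {d} {y} {z} cd cy yz with z ≟ c | z ≟ d | y ≟ d
      ... | yes refl | _ | _ = inj₂ (sym G cd)
      ... | no _ | yes refl | _ = inj₁ cd
      ... | no _ | no _ | yes refl = inj₂ yz
      ... | no z≢c | no z≢d | no y≢d =
        inj₂ (path-closed (sym G cd) cy yz (≢-sym y≢d) (≢-sym z≢c) (≢-sym z≢d))
      go : ∀ {y} → Adj G a y ⊎ Adj G b y → Star (Adj G) y x → Adj G a x ⊎ Adj G b x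
      go on ε = on
      go (inj₁ ay) (yz ◅ zs) = go (advance ab ay yz) zs
      go (inj₂ by) (yz ◅ zs) = go ([ inj₂ , inj₁ ]′ (advance (sym G ab) by yz)) zs

    far⇒near : ∀ {x} → ¬ Adj G a x → Adj G b x
    far⇒near {x} ¬ax with near x
    ... | inj₁ ax = contradiction ax ¬ax
    ... | inj₂ bx = bx

    -- `partner` swaps the neighbours of `a` with the other vertices, because two adjacent
    -- neighbours of `a`, or of `b`, would form a triangle.
    split = involution⇒halves partner partner-involutive (adj? G a)
      (λ {x} ax → ¬triangle ax (partner-adj x) ∘ sym G)
      (λ {x} ¬ax → [ id , (λ by → contradiction (sym G by)
                                    (¬triangle (far⇒near ¬ax) (partner-adj x))) ]′ (near (partner x)))

    m : ℕ
    m = proj₁ split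
    at : Fin m ⊎ Fin m → Fin n
    at = Inverse.to (proj₁ (proj₂ split))

    side-nonempty : Fin m ⊎ Fin m → 1 ≤ m
    side-nonempty = [ nonempty , nonempty ]′
      where
      nonempty : ∀ {k} → Fin k → 1 ≤ k
      nonempty zero    = s≤s z≤n
      nonempty (suc _) = s≤s z≤n

    at-left : ∀ i → Adj G a (at (inj₁ i))
    at-left = proj₁ (proj₂ (proj₂ split))
    at-right : ∀ j → Adj G b (at (inj₂ j))
    at-right j = far⇒near (proj₂ (proj₂ (proj₂ split)) j)

    -- The path `x a b y` closes up. Its ends differ, since a common neighbour of `a` and `b` would
    -- form a triangle.
    across : ∀ {x y} → Adj G a x → Adj G b y → Adj G x y
    across {x} {y} ax by with x ≟ b | y ≟ a
    ... | yes refl | _ = by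
    ... | no _ | yes refl = sym G ax
    ... | no x≢b | no y≢a = path-closed (sym G ax) ab by x≢b (≢-sym y≢a)
                              (λ { refl → ¬triangle ab by (sym G ax) })

    adjacent : ∀ s t → Adj G (at s) (at t) ⇔ Adj K[ m , m ] s t
    adjacent (inj₁ i) (inj₁ j) =
      mk⇔ (λ ij → ¬triangle (at-left i) ij (sym G (at-left j))) (λ ())
    adjacent (inj₁ i) (inj₂ j) = mk⇔ (λ _ → tt) (λ _ → across (at-left i) (at-right j))
    adjacent (inj₂ i) (inj₁ j) = mk⇔ (λ _ → tt) (λ _ → sym G (across (at-left j) (at-right i)))
    adjacent (inj₂ i) (inj₂ j) =
      mk⇔ (λ ij → ¬triangle (at-right i) ij (sym G (at-right j))) (λ ())

-- Simple paths, acyclic graphs and cycles.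

record SimplePath (R : Rel (Fin n) 0ℓ) (x y : Fin n) : Set where
  field
    len       : ℕ
    vertex        : Fin (suc len) → Fin n
    injective : ∀ {i j} → vertex i ≡ vertex j → i ≡ j
    start     : vertex zero ≡ x
    end       : vertex (fromℕ len) ≡ y
    step      : ∀ i → R (vertex (inject₁ i)) (vertex (suc i))

open SimplePath

suffix : {R : Rel (Fin n) 0ℓ} {x y : Fin n} (p : SimplePath R x y) (i : Fin (suc (len p))) →
         SimplePath R (vertex p i) y
suffix p zero = record { SimplePath p ; start = refl }
suffix record { len = suc l ; vertex = vertex ; injective = inj ; end = end ; step = step } (suc i) =
  suffix (record { len = l ; vertex = vertex ∘ suc ; injective = λ eq → suc-injective (inj eq)
                 ; start = refl ; end = end ; step = step ∘ suc }) i

-- Loop erasure: if `x` already occurs on the simplified rest, the suffix from that occurrence is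
-- taken.
simplify : {R : Rel (Fin n) 0ℓ} {x y : Fin n} → Star R x y → SimplePath R x y
simplify {x = x} ε = record
  { len = 0 ; vertex = λ _ → x ; injective = λ { {zero} {zero} _ → refl }
  ; start = refl ; end = refl ; step = λ () }
simplify {R = R} {x} (_◅_ {j = z} xz zs) with p ← simplify zs with any? (λ i → vertex p i ≟ x)
... | yes (i , refl) = suffix p i
... | no x∉p = record
  { len = suc (len p) ; vertex = vertex′ ; injective = inj′
  ; start = refl ; end = end p ; step = step′ }
  where
  vertex′ : Fin (suc (suc (len p))) → Fin _
  vertex′ zero    = x
  vertex′ (suc i) = vertex p i
  inj′ : ∀ {i j} → vertex′ i ≡ vertex′ j → i ≡ j
  inj′ {zero}  {zero}  _  = refl
  inj′ {zero}  {suc j} eq = contradiction (j , ≡.sym eq) x∉p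
  inj′ {suc i} {zero}  eq = contradiction (i , eq) x∉p
  inj′ {suc i} {suc j} eq = cong suc (injective p eq)
  step′ : ∀ i → R (vertex′ (inject₁ i)) (vertex′ (suc i))
  step′ zero    = subst (R x) (≡.sym (start p)) xz
  step′ (suc i) = step p i

-- Closing a simple path of G ∖ F with an edge of F gives a cycle.
acyclic⇒no-deletion : (G F : Graph (Fin n)) → Acyclic G → F ⊆ G → Connected (G ∖ F) →
                      ∀ {u v} → ¬ Adj F u v
acyclic⇒no-deletion {n} G F acyclic F⊆G (_ , conn) {u} {v} uv =
  close (simplify (conn u v))
  where
  close : ¬ SimplePath (Adj (G ∖ F)) u v
  close record { len = zero ; start = refl ; end = refl } = irrefl F uv
  close record { len = suc zero ; start = refl ; end = refl ; step = step } =
    proj₂ (step zero) uv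
  close record { len = len@(suc (suc _)) ; vertex = vertex ; injective = inj
               ; start = start ; end = end ; step = step } =
    acyclic (suc len) (s≤s (s≤s (s≤s z≤n)))
      (mk↣ inj , λ { (_ , inj₁ ij) → next ij ; (_ , inj₂ ji) → sym G (next ji) })
    where
    next : ∀ {i j} → Next i j → Adj G (vertex i) (vertex j)
    next {i} {suc j} (inj₁ eq)
      with refl ← toℕ-injective {i = i} {inject₁ j}
                    (trans (ℕ.suc-injective (≡.sym eq)) (≡.sym (toℕ-inject₁ j))) =
      proj₁ (step j)
    -- The wrap-around leads from the end `v` back to the start `u`, which is where the edge of `F`
    -- enters.
    next {i} {zero} (inj₂ (eq , _))
      with refl ← toℕ-injective {i = i} {fromℕ len}
                    (trans (ℕ.suc-injective eq) (≡.sym (toℕ-fromℕ len))) =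
      subst₂ (Adj G) (≡.sym end) (≡.sym start) (sym G (F⊆G uv))

-- A deletion that keeps an acyclic graph connected is empty, so `M` loses no edge.
acyclic⇒U : {G : Graph (Fin n)} → Acyclic G → (k : ℕ ⁺) → U-MM k G
acyclic⇒U {G = G} acyclic k M mm F F⊆G _ conn = isMaximalMatching
  (λ (uv , uv∉F) → subset mm uv , uv∉F)
  (λ (xy , _) (xz , _) → matching mm xy xz)
  (λ (uv , _) → [ inj₁ ∘ keep , inj₂ ∘ keep ]′ (dominating mm uv))
  where
  keep : ∀ {u} → Covered M u → Covered (M ∖ F) u
  keep (v , uv) = v , uv , acyclic⇒no-deletion G F acyclic F⊆G conn

-- Vertex `0` of the cycle is the corner `y`. Its cyclic neighbours are `1` and the last vertex, and
-- the rest of the cycle joins these while avoiding `0`.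
cycle⇒corner : {G : Graph (Fin n)} → ∀ {m} → 3 ≤ m → C m ↪ G →
               ∃[ x ] ∃[ y ] ∃[ z ] Adj G y x × Adj G y z × x ≢ z × Star (Adj (avoid G y)) x z
cycle⇒corner {G = G} {suc (suc (suc k))} (s≤s (s≤s (s≤s z≤n))) (f , hom) =
    to (suc zero) , to zero , to (fromℕ (suc (suc k)))
  , hom ((λ ()) , inj₁ (inj₁ refl))
  , hom ((λ ()) , inj₂ (inj₂ (cong (λ l → suc (suc (suc l))) (toℕ-fromℕ k) , refl)))
  , (λ eq → contradiction (injective′ eq) λ ())
  , <-weakInduction (λ i → Star (Adj (avoid G (to zero))) (to (suc zero)) (to (suc i)))
      ε (λ i path → path ◅◅ Star.return (advance i)) (fromℕ (suc k))
  where
  open Injection f using (to) renaming (injective to injective′)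
  next : ∀ (i : Fin (suc k)) → toℕ (suc (suc i)) ≡ suc (toℕ (suc (inject₁ i)))
  next i = cong (λ l → suc (suc l)) (≡.sym (toℕ-inject₁ i))
  advance : ∀ i → Adj (avoid G (to zero)) (to (suc (inject₁ i))) (to (suc (suc i)))
  advance i = hom ((λ eq → ℕ.1+n≢n (trans (≡.sym (next i)) (≡.sym (cong toℕ eq)))) , inj₁ (inj₁ (next i)))
            , (λ eq → contradiction (injective′ eq) λ ()) , (λ eq → contradiction (injective′ eq) λ ())

-- From arbitrary cycles to 4-cycles.

module _ (G : Graph (Fin n)) (conn : Connected G) (U : U-MM [ 1 ] G) where
  open OneRobust G conn U

  -- The rest of the cycle bypasses each of the two edges at the corner, so `square-from-detours`
  -- applies to the path `x y z`.
  cycle⇒square : ∀ {m} → 3 ≤ m → C m ↪ G → ∃[ x ] OnSquare G x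
  cycle⇒square 3≤m cycle
    with x , y , z , yx , yz , x≢z , path ← cycle⇒corner {G = G} 3≤m cycle
    with q , sq ← square-from-detours (sym G yx) yz x≢z
           (detour-sym G (corner-detour G yz (≢-sym x≢z) (Star.reverse (sym (avoid G y)) path)))
           (corner-detour G yx x≢z path) =
    x , y , z , q , sq

  -- A finite search decides whether there is a 4-cycle, and its failure excludes cycles of every
  -- length.
  acyclic-or-square : Acyclic G ⊎ ∃[ x ] OnSquare G x
  acyclic-or-square with any? (onSquare? G)
  ... | yes square   = inj₂ square
  ... | no no-square = inj₁ λ m 3≤m cycle → no-square (cycle⇒square 3≤m cycle)

-- Robustness from perfect matchings, and the two dense families.

perfect⇒maximal : (G F M : Graph (Fin n)) → IsMaximalMatching G M → Perfect M →
  (∀ {u v u′ v′} → Adj (G ∖ F) u v → Adj M u u′ → Adj M v v′ → u′ ≢ v →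
                   Adj F u u′ → ¬ Adj F v v′) →
  IsMaximalMatching (G ∖ F) (M ∖ F)
perfect⇒maximal G F M mm perfect survives = isMaximalMatching
  (λ (uv , uv∉F) → subset mm uv , uv∉F) (λ (xy , _) (xz , _) → matching mm xy xz) dom
  where
  dom : Dominates (M ∖ F) (G ∖ F)
  dom {u} {v} uv@(_ , uv∉F) with u′ , uu′ ← perfect u with v′ , vv′ ← perfect v
    with adj? F u u′ | adj? F v v′
  ... | no uu′∉F | _        = inj₁ (u′ , uu′ , uu′∉F)
  ... | yes _    | no vv′∉F = inj₂ (v′ , vv′ , vv′∉F)
  -- The two deleted matching edges are distinct, since `uv` itself was not deleted.
  ... | yes uu′∈F | yes vv′∈F =
    contradiction vv′∈F (survives uv uu′ vv′ (λ { refl → uv∉F uu′∈F }) uu′∈F)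

-- An edge with both ends left free would need two distinct deleted matching edges.
perfect⇒1-robust : (G : Graph (Fin n)) → (∀ M → IsMaximalMatching G M → Perfect M) → U-MM [ 1 ] G
perfect⇒1-robust G perfect M mm F _ [ ∣F∣≤1 ] _ = perfect⇒maximal G F M mm (perfect M mm)
  λ {u} {v} {u′} uv _ _ u′≢v uu′∈F vv′∈F →
    [ (λ v≡u → adj⇒≢ G (proj₁ uv) (≡.sym v≡u)) , (λ v≡u′ → u′≢v (≡.sym v≡u′)) ]′
      (∣∣≤1⇒same F ∣F∣≤1 uu′∈F vv′∈F)

≅-trans : {U : Set} {G : Graph U} {H : Graph V} {I : Graph W} → G ≅ H → H ≅ I → G ≅ I
≅-trans (e , adj-e) (f , adj-f) =
  f ↔-∘ e , λ u v → adj-f (Inverse.to e u) (Inverse.to e v) ⇔-∘ adj-e u v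

↔-injective : (e : V ↔ W) → ∀ {x y} → Inverse.to e x ≡ Inverse.to e y → x ≡ y
↔-injective e {x} {y} eq = trans (≡.sym (Inverse.strictlyInverseʳ e x))
  (trans (cong (Inverse.from e) eq) (Inverse.strictlyInverseʳ e y))

K-swap : ∀ m → K[ m , m ] ≅ K[ m , m ]
K-swap m = swap-↔ , swapped
  where
  swapped : ∀ s t → Adj K[ m , m ] s t ⇔ Adj K[ m , m ] (swap s) (swap t)
  swapped (inj₁ _) (inj₁ _) = mk⇔ id id
  swapped (inj₁ _) (inj₂ _) = mk⇔ id id
  swapped (inj₂ _) (inj₁ _) = mk⇔ id id
  swapped (inj₂ _) (inj₂ _) = mk⇔ id id

-- If u is free, then all m vertices of the other side are matched into the
-- remaining m - 1 vertices of the side of u.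
left-covered : {G : Graph (Fin n)} {m : ℕ} (iso : G ≅ K[ m , m ]) →
               ∀ M → IsMaximalMatching G M →
               ∀ u {i} → Inverse.to (proj₁ iso) u ≡ inj₁ i → Covered M u
left-covered {n} {G} {m} (e , adjacent) M mm u {i} u-left =
  decidable-stable (covered? M u) λ u∉ → ℕ.1+n≰n (injective⇒≤ (match-injective u∉))
  where
  open Inverse e using (to; from; strictlyInverseˡ)
  right : Fin m → Fin n
  right j = from (inj₂ j)
  u-right : ∀ j → Adj G u (right j)
  u-right j = Equivalence.from (adjacent u (right j))
    (subst₂ (Adj K[ m , m ]) (≡.sym u-left) (≡.sym (strictlyInverseˡ (inj₂ j))) tt)
  to-left : ∀ {j} s → Adj K[ m , m ] (inj₂ j) s → ∃[ i ] s ≡ inj₁ i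
  to-left (inj₁ i) _ = i , refl
  partner : ¬ Covered M u → ∀ j → ∃[ w ] Adj M (right j) w × ∃[ i ] to w ≡ inj₁ i
  partner u∉ j with dominating mm (u-right j)
  ... | inj₁ u∈ = contradiction u∈ u∉
  ... | inj₂ (w , jw) = w , jw , to-left (to w)
    (subst (λ s → Adj K[ m , m ] s (to w)) (strictlyInverseˡ (inj₂ j))
      (Equivalence.to (adjacent (right j) w) (subset mm jw)))
  match : ¬ Covered M u → Fin (suc m) → Fin m
  -- Index `zero` stands for the free vertex `u` itself, so that `m + 1` indices inject into `m`
  -- positions.
  match u∉ zero    = i
  match u∉ (suc j) = proj₁ (proj₂ (proj₂ (partner u∉ j)))
  match-injective : ∀ u∉ {j k} → match u∉ j ≡ match u∉ k → j ≡ k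
  match-injective u∉ {zero} {zero} _ = refl
  match-injective u∉ {zero} {suc k} eq with w , kw , _ , w-left ← partner u∉ k
    with refl ← ↔-injective e {u} {w} (trans u-left (trans (cong inj₁ eq) (≡.sym w-left))) =
    contradiction (_ , sym M kw) u∉
  match-injective u∉ {suc j} {zero} eq with w , jw , _ , w-left ← partner u∉ j
    with refl ← ↔-injective e {u} {w} (trans u-left (trans (cong inj₁ (≡.sym eq)) (≡.sym w-left))) =
    contradiction (_ , sym M jw) u∉
  match-injective u∉ {suc j} {suc k} eq
    with w , jw , _ , w-left ← partner u∉ j | x , kx , _ , x-left ← partner u∉ k
    with refl ← ↔-injective e {w} {x} (trans w-left (trans (cong inj₁ eq) (≡.sym x-left))) =
    cong suc (inj₂-injective (↔-injective (↔-sym e) (matching mm (sym M jw) (sym M kx))))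

balanced⇒perfect : {G : Graph (Fin n)} {m : ℕ} → G ≅ K[ m , m ] →
                   ∀ M → IsMaximalMatching G M → Perfect M
balanced⇒perfect {G = G} {m} iso M mm u with Inverse.to (proj₁ iso) u in eq
... | inj₁ _ = left-covered iso M mm u eq
... | inj₂ _ = left-covered (≅-trans {G = G} {K[ m , m ]} {K[ m , m ]} iso (K-swap m)) M mm u (cong swap eq)

-- A single free vertex w could be matched with an extra vertex, so n and n + 1
-- would both be even.
even-complete⇒perfect : {G : Graph (Fin n)} {m : ℕ} → 2 ∣ m → G ≅ K m →
                        ∀ M → IsMaximalMatching G M → Perfect M
even-complete⇒perfect {n} {G} {m} 2∣m (e , adjacent) M mm w = decidable-stable (covered? M w) λ w∉ →
  contradiction (∣1⇒≡1 (∣m+n∣m⇒∣n (subst (2 ∣_) (ℕ.+-comm 1 n) (2∣1+n w∉)) 2∣n)) λ ()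
  where
  2∣n : 2 ∣ n
  2∣n = subst (2 ∣_) (≡.sym (↔⇒≡ e)) 2∣m
  rest-covered : ¬ Covered M w → ∀ {x} → ¬ Covered M x → x ≡ w
  rest-covered w∉ {x} x∉ = decidable-stable (x ≟ w) λ x≢w →
    [ x∉ , w∉ ]′ (dominating mm (Equivalence.from (adjacent x w) (x≢w ∘ ↔-injective e)))
  -- `zero` is the extra vertex and `suc x` is the vertex `x`. When `w` is free, the value `zero` is
  -- taken only at `suc w`, by `rest-covered`.
  mate : Fin (suc n) → Fin (suc n)
  mate zero = suc w
  mate (suc x) with covered? M x
  ... | yes (y , _) = suc y
  ... | no  _       = zero
  mate-≢ : ∀ x → mate x ≢ x
  mate-≢ (suc x) eq with covered? M x
  ... | yes (y , xy) = adj⇒≢ M xy (≡.sym (suc-injective eq))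
  mate-involutive : ¬ Covered M w → ∀ x → mate (mate x) ≡ x
  mate-involutive w∉ zero with covered? M w
  ... | yes w∈ = contradiction w∈ w∉
  ... | no _   = refl
  mate-involutive w∉ (suc x) with covered? M x
  ... | no x∉ = cong suc (≡.sym (rest-covered w∉ x∉))
  ... | yes (y , xy) with covered? M y
  ... | yes (z , yz) = cong suc (matching mm yz (sym M xy))
  ... | no y∉ = contradiction (x , sym M xy) y∉
  2∣1+n : ¬ Covered M w → 2 ∣ suc n
  2∣1+n w∉ = involution⇒even mate (mate-involutive w∉) mate-≢

-- Robustness of the 4-cycle.

C₄≅K₂₂ : C 4 ≅ K[ 2 , 2 ]
C₄≅K₂₂ = mk↔ₛ′ to from
    (λ { (inj₁ zero) → refl ; (inj₁ (suc zero)) → refl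
       ; (inj₂ zero) → refl ; (inj₂ (suc zero)) → refl })
    (from-yes (all? λ i → from (to i) ≟ i))
  , λ i j → mk⇔ (from-yes (all? λ i → all? λ j → adj? (C 4) i j →-dec adj? K[ 2 , 2 ] (to i) (to j)) i j)
                (from-yes (all? λ i → all? λ j → adj? K[ 2 , 2 ] (to i) (to j) →-dec adj? (C 4) i j) i j)
  where
  to : Fin 4 → Fin 2 ⊎ Fin 2
  to zero                   = inj₁ zero
  to (suc zero)             = inj₂ zero
  to (suc (suc zero))       = inj₁ (suc zero)
  to (suc (suc (suc zero))) = inj₂ (suc zero)
  from : Fin 2 ⊎ Fin 2 → Fin 4
  from (inj₁ zero)       = zero
  from (inj₂ zero)       = suc zero
  from (inj₁ (suc zero)) = suc (suc zero)
  from (inj₂ (suc zero)) = suc (suc (suc zero))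

Fin2-exhausted : (j k l : Fin 2) → j ≢ k → l ≡ j ⊎ l ≡ k
Fin2-exhausted zero       zero       _          j≢k = contradiction refl j≢k
Fin2-exhausted zero       (suc zero) zero       _   = inj₁ refl
Fin2-exhausted zero       (suc zero) (suc zero) _   = inj₂ refl
Fin2-exhausted (suc zero) zero       zero       _   = inj₂ refl
Fin2-exhausted (suc zero) zero       (suc zero) _   = inj₁ refl
Fin2-exhausted (suc zero) (suc zero) _          j≢k = contradiction refl j≢k

-- The neighbours of `r` form a side of two vertices, which `s` and `t` exhaust.
K₂₂-degree : ∀ r s t u → Adj K[ 2 , 2 ] r s → Adj K[ 2 , 2 ] r t → s ≢ t →
             Adj K[ 2 , 2 ] r u → u ≡ s ⊎ u ≡ t
K₂₂-degree (inj₁ _) (inj₂ j) (inj₂ k) (inj₂ l) _ _ s≢t _ =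
  Sum.map (cong inj₂) (cong inj₂) (Fin2-exhausted j k l (s≢t ∘ cong inj₂))
K₂₂-degree (inj₂ _) (inj₁ j) (inj₁ k) (inj₁ l) _ _ s≢t _ =
  Sum.map (cong inj₁) (cong inj₁) (Fin2-exhausted j k l (s≢t ∘ cong inj₁))

-- Deleting two opposite edges uu′ and vv′ of a 4-cycle would isolate the edge uv.
C₄⇒U : {G : Graph (Fin n)} → G ≅ C 4 → (k : ℕ ⁺) → U-MM k G
C₄⇒U {n} {G} iso₄ k M mm F F⊆G _ (_ , conn) =
  perfect⇒maximal G F M mm (balanced⇒perfect {G = G} {2} iso M mm)
    λ uv uu′ vv′ u′≢v uu′∈F vv′∈F → isolated uv (subset mm uu′) (subset mm vv′) u′≢v uu′∈F vv′∈F
  where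
  iso : G ≅ K[ 2 , 2 ]
  iso = ≅-trans {G = G} {C 4} {K[ 2 , 2 ]} iso₄ C₄≅K₂₂
  to : Fin n → Fin 2 ⊎ Fin 2
  to = Inverse.to (proj₁ iso)
  to-injective : ∀ {x y} → to x ≡ to y → x ≡ y
  to-injective = ↔-injective (proj₁ iso)
  to-adj : ∀ {x y} → Adj G x y → Adj K[ 2 , 2 ] (to x) (to y)
  to-adj {x} {y} = Equivalence.to (proj₂ iso x y)
  degree : ∀ {x y z w} → Adj G x y → Adj G x z → y ≢ z → Adj G x w → w ≡ y ⊎ w ≡ z
  degree {x} {y} {z} {w} xy xz y≢z xw = Sum.map to-injective to-injective
    (K₂₂-degree (to x) (to y) (to z) (to w) (to-adj xy) (to-adj xz) (y≢z ∘ to-injective) (to-adj xw))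
  isolated : ∀ {u v u′ v′} → Adj (G ∖ F) u v → Adj G u u′ → Adj G v v′ → u′ ≢ v →
             Adj F u u′ → ¬ Adj F v v′
  isolated {u} {v} {u′} {v′} (uv , uv∉F) uu′ vv′ u′≢v uu′∈F vv′∈F =
    [ adj⇒≢ G uu′ ∘ ≡.sym , u′≢v ]′ (stay (inj₁ refl) (conn u u′))
    where
    -- Each of `u` and `v` has degree two and has lost its other edge, so a walk cannot leave them.
    stay : ∀ {x y} → x ≡ u ⊎ x ≡ v → Star (Adj (G ∖ F)) x y → y ≡ u ⊎ y ≡ v
    stay at ε = at
    stay (inj₁ refl) ((xz , xz∉F) ◅ zs) with degree uv uu′ (≢-sym u′≢v) xz
    ... | inj₁ refl = stay (inj₂ refl) zs
    ... | inj₂ refl = contradiction uu′∈F xz∉F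
    stay (inj₂ refl) ((xz , xz∉F) ◅ zs)
      with degree (sym G uv) vv′ (λ { refl → uv∉F (sym F vv′∈F) }) xz
    ... | inj₁ refl = stay (inj₁ refl) zs
    ... | inj₂ refl = contradiction vv′∈F xz∉F

-- Consequences of 2-robustness.

module TwoRobust {n} (G : Graph (Fin n)) (conn : Connected G) (U : U-MM [ 2 ] G)
                 (perfect : ∀ M → IsMaximalMatching G M → Perfect M) where
  open RandomlyMatchable G perfect

  -- Deleting ab and cd makes bc addable, so it must disconnect the graph; but
  -- any further neighbour of a is also adjacent to c, or is c itself.
  square-neighbours : ∀ {a b c d z} → Square G a b c d → Adj G a z → z ≡ b ⊎ z ≡ d
  square-neighbours {a} {b} {c} {d} {z} (ab , bc , cd , da , a≢c , b≢d) az
    with z ≟ b | z ≟ d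
  ... | yes z≡b | _       = inj₁ z≡b
  ... | no _    | yes z≡d = inj₂ z≡d
  ... | no z≢b  | no z≢d  = ⊥-elim not-robust
    where
    open Pair a b c d (adj⇒≢ G ab) (adj⇒≢ G cd) (a≢c , ≢-sym (adj⇒≢ G da)) (adj⇒≢ G bc , b≢d)
    survives : ∀ {x y w} → Adj pair x y → y ≢ w → Adj G x w → Adj (G ∖ pair) x w
    survives xy y≢w xw = xw , partner-unique pair pair-matching xy y≢w
    bc′ : Adj (G ∖ pair) b c
    bc′ = survives (sym pair ab∈pair) a≢c bc
    da′ : Adj (G ∖ pair) d a
    da′ = survives (sym pair cd∈pair) (≢-sym a≢c) da
    a⟶c : Star (Adj (G ∖ pair)) a c
    a⟶c with z ≟ c
    ... | yes refl = Star.return (survives ab∈pair (≢-sym z≢b) az)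
    ... | no z≢c =
      survives ab∈pair (≢-sym z≢b) az ◅
      sym (G ∖ pair) (survives cd∈pair (≢-sym z≢d)
        (sym G (path-closed (sym G az) ab bc z≢b a≢c z≢c))) ◅ ε
    -- As `bc` and `da` survive, the walk from `a` to `c` joins the ends of both deleted edges.
    a⟶b : Star (Adj (G ∖ pair)) a b
    a⟶b = a⟶c ◅◅ Star.return (sym (G ∖ pair) bc′)
    d⟶c : Star (Adj (G ∖ pair)) d c
    d⟶c = da′ ◅ a⟶c
    back : ∀ {x y} → Star (Adj (G ∖ pair)) x y → Star (Adj (G ∖ pair)) y x
    back = Star.reverse (sym (G ∖ pair))
    bypass : ∀ {x y} → Adj pair x y → Star (Adj (G ∖ pair)) x y
    bypass xy with pair-edge xy
    ... | inj₁ (inj₁ (refl , refl)) = a⟶b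
    ... | inj₁ (inj₂ (refl , refl)) = back a⟶b
    ... | inj₂ (inj₁ (refl , refl)) = back d⟶c
    ... | inj₂ (inj₂ (refl , refl)) = d⟶c
    not-robust : ⊥
    not-robust with M , pair⊆M , mm ← extend G pair (pair-⊆ G ab cd) pair-matching =
      maximal (U M mm pair (pair-⊆ G ab cd) [ ∣pair∣≤2 ] (reconnect {G = G} {pair} conn bypass)) bc′
        (λ (bc∈M , _) → a≢c (matching mm (sym M (pair⊆M ab∈pair)) bc∈M))
        (add-matching (M ∖ pair) (adj⇒≢ G bc) (λ p q → matching mm (proj₁ p) (proj₁ q))
          (uncovered (sym pair ab∈pair)) (uncovered cd∈pair))
      where
      uncovered : ∀ {x y} → Adj pair x y → ¬ Covered (M ∖ pair) x
      uncovered {x} xy (w , xw , xw∉pair) =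
        xw∉pair (subst (Adj pair x) (matching mm (pair⊆M xy) xw) xy)

  -- By `square-neighbours`, applied to every rotation, walks from `a` stay on the 4-cycle. It also
  -- excludes the chords `ac` and `bd`.
  square⇒C₄ : ∀ {a b c d} → Square G a b c d → G ≅ C 4
  square⇒C₄ {a} {b} {c} {d} sq₀@(ab , bc , cd , da , a≢c , b≢d) =
    ≅-inverse {G = G} {C 4} (mk↔ₛ′ at (proj₁ ∘ position) (proj₂ ∘ position)
      (λ i → lookup-injective distinct (proj₂ (position (at i))))) adjacent
    where
    at : Fin 4 → Fin n
    at = lookup (a ∷ b ∷ c ∷ d ∷ [])
    distinct : Unique (a ∷ b ∷ c ∷ d ∷ [])
    distinct = (adj⇒≢ G ab ∷ a≢c ∷ ≢-sym (adj⇒≢ G da) ∷ []) ∷ (adj⇒≢ G bc ∷ b≢d ∷ [])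
             ∷ (adj⇒≢ G cd ∷ []) ∷ [] ∷ []
    sq₁ = square-rotate G sq₀
    sq₂ = square-rotate G sq₁
    sq₃ = square-rotate G sq₂

    position : ∀ v → ∃[ i ] at i ≡ v
    position v = go (zero , refl) (proj₂ conn a v)
      where
      advance : ∀ {x y} → ∃[ i ] at i ≡ x → Adj G x y → ∃[ i ] at i ≡ y
      advance (zero , refl) xy with square-neighbours sq₀ xy
      ... | inj₁ refl = suc zero , refl
      ... | inj₂ refl = suc (suc (suc zero)) , refl
      advance (suc zero , refl) xy with square-neighbours sq₁ xy
      ... | inj₁ refl = suc (suc zero) , refl
      ... | inj₂ refl = zero , refl
      advance (suc (suc zero) , refl) xy with square-neighbours sq₂ xy
      ... | inj₁ refl = suc (suc (suc zero)) , refl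
      ... | inj₂ refl = suc zero , refl
      advance (suc (suc (suc zero)) , refl) xy with square-neighbours sq₃ xy
      ... | inj₁ refl = zero , refl
      ... | inj₂ refl = suc (suc zero) , refl
      go : ∀ {x} → ∃[ i ] at i ≡ x → Star (Adj G) x v → ∃[ i ] at i ≡ v
      go p ε         = p
      go p (xy ◅ ys) = go (advance p xy) ys

    ¬ac : ¬ Adj G a c
    ¬ac ac = [ adj⇒≢ G bc ∘ ≡.sym , adj⇒≢ G cd ]′ (square-neighbours sq₀ ac)
    ¬bd : ¬ Adj G b d
    ¬bd bd = [ adj⇒≢ G cd ∘ ≡.sym , adj⇒≢ G da ]′ (square-neighbours sq₁ bd)

    adjacent : ∀ i j → Adj G (at i) (at j) ⇔ Adj (C 4) i j
    adjacent zero                   zero                   = neither (irrefl G) (from-no (adj? (C 4) (# 0) (# 0)))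
    adjacent zero                   (suc zero)             = both ab (from-yes (adj? (C 4) (# 0) (# 1)))
    adjacent zero                   (suc (suc zero))       = neither ¬ac (from-no (adj? (C 4) (# 0) (# 2)))
    adjacent zero                   (suc (suc (suc zero))) = both (sym G da) (from-yes (adj? (C 4) (# 0) (# 3)))
    adjacent (suc zero)             zero                   = both (sym G ab) (from-yes (adj? (C 4) (# 1) (# 0)))
    adjacent (suc zero)             (suc zero)             = neither (irrefl G) (from-no (adj? (C 4) (# 1) (# 1)))
    adjacent (suc zero)             (suc (suc zero))       = both bc (from-yes (adj? (C 4) (# 1) (# 2)))
    adjacent (suc zero)             (suc (suc (suc zero))) = neither ¬bd (from-no (adj? (C 4) (# 1) (# 3)))
    adjacent (suc (suc zero))       zero                   = neither (¬ac ∘ sym G) (from-no (adj? (C 4) (# 2) (# 0)))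
    adjacent (suc (suc zero))       (suc zero)             = both (sym G bc) (from-yes (adj? (C 4) (# 2) (# 1)))
    adjacent (suc (suc zero))       (suc (suc zero))       = neither (irrefl G) (from-no (adj? (C 4) (# 2) (# 2)))
    adjacent (suc (suc zero))       (suc (suc (suc zero))) = both cd (from-yes (adj? (C 4) (# 2) (# 3)))
    adjacent (suc (suc (suc zero))) zero                   = both da (from-yes (adj? (C 4) (# 3) (# 0)))
    adjacent (suc (suc (suc zero))) (suc zero)             = neither (¬bd ∘ sym G) (from-no (adj? (C 4) (# 3) (# 1)))
    adjacent (suc (suc (suc zero))) (suc (suc zero))       = both (sym G cd) (from-yes (adj? (C 4) (# 3) (# 2)))
    adjacent (suc (suc (suc zero))) (suc (suc (suc zero))) = neither (irrefl G) (from-no (adj? (C 4) (# 3) (# 3)))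

-- Assembly of both classifications.

theorem9 : ((n : ℕ) (G : Graph (Fin n)) → Connected G →
    U-MM [ 1 ] G ⇔ (IsTree G ⊎ IsBalancedCompleteBipartite G ⊎ IsEvenComplete G))
    ×
    ((k : ℕ ⁺) → [ 2 ] ≤⁺ k →
    (n : ℕ) (G : Graph (Fin n)) → Connected G →
    U-MM k G ⇔ (G ≅ C 4 ⊎ IsTree G))
theorem9 = (λ n G conn → mk⇔ (one⇒ G conn) (one⇐ G))
         , (λ k 2≤k n G conn → mk⇔ (two⇒ 2≤k G conn) (two⇐ k G))
  where
  one⇒ : (G : Graph (Fin n)) → Connected G → U-MM [ 1 ] G →
         IsTree G ⊎ IsBalancedCompleteBipartite G ⊎ IsEvenComplete G
  one⇒ G conn U with acyclic-or-square G conn U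
  ... | inj₁ acyclic = inj₁ (conn , acyclic)
  ... | inj₂ (_ , on@(_ , _ , _ , xy , _)) = inj₂
    (RandomlyMatchable.complete-or-bipartite G (OneRobust.square⇒perfect G conn U on) conn xy)

  one⇐ : (G : Graph (Fin n)) →
         IsTree G ⊎ IsBalancedCompleteBipartite G ⊎ IsEvenComplete G → U-MM [ 1 ] G
  one⇐ G (inj₁ (_ , acyclic))          = acyclic⇒U acyclic [ 1 ]
  one⇐ G (inj₂ (inj₁ (m , _ , iso)))   = perfect⇒1-robust G (balanced⇒perfect {G = G} {m} iso)
  one⇐ G (inj₂ (inj₂ (m , 2∣m , iso))) = perfect⇒1-robust G (even-complete⇒perfect {G = G} 2∣m iso)

  two⇒ : {k : ℕ ⁺} → [ 2 ] ≤⁺ k → (G : Graph (Fin n)) → Connected G → U-MM k G → G ≅ C 4 ⊎ IsTree G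
  -- The bound is lowered to two and then to one, so the structure of the 1-robust class is
  -- available.
  two⇒ 2≤k G conn U with U₂ ← U-anti {G = G} 2≤k U
    with U₁ ← U-anti {G = G} [ s≤s z≤n ] U₂
    with acyclic-or-square G conn U₁
  ... | inj₁ acyclic = inj₂ (conn , acyclic)
  ... | inj₂ (_ , on@(_ , _ , _ , sq)) = inj₁
    (TwoRobust.square⇒C₄ G conn U₂ (OneRobust.square⇒perfect G conn U₁ on) sq)

  two⇐ : (k : ℕ ⁺) (G : Graph (Fin n)) → G ≅ C 4 ⊎ IsTree G → U-MM k G
  two⇐ k G (inj₁ iso)           = C₄⇒U {G = G} iso k
  two⇐ k G (inj₂ (_ , acyclic)) = acyclic⇒U acyclic k
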